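{- Let $\mathcal{D}$ be a $2-(v,k,1)$ design, $k\geq4$, with $r=\frac{v-1}{k-1}\geq k^{2}-3k+\frac{3}{4}\sqrt{k}+2$, and let $\mathcal{S}$ be an Erdős-Ko-Rado set on $\mathcal{D}$. Then $|\mathcal{S}|\leq r$. If $r\neq k^{2}-k+1$ and $(r,k)\neq(8,4)$, then $|\mathcal{S}|=r$ if and only if $\mathcal{S}$ is a point-pencil.
   Context: A $2-(v,k,1)$ design, with integers $v>k>1$, consists of a set $\mathcal{P}$ of $v$ points together with a set $\mathcal{B}$ of $k$-subsets of $\mathcal{P}$ (blocks) such that any two distinct points are contained in exactly one block. Every point then lies on exactly $r=\frac{v-1}{k-1}$ blocks. An Erdős-Ko-Rado set on a design is a set of pairwise intersecting blocks. A point-pencil is the set of all blocks through a fixed point. -}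

module Defs where

open import Data.Fin using (Fin)
open import Data.Fin.Subset using (Subset; ∣_∣; _∩_; Nonempty) renaming (_∈_ to _∈ₛ_)
open import Data.Integer as ℤ using (ℤ; +_; 0ℤ)
open import Data.List using (List)
open import Data.List.Membership.Propositional using (_∈_)
open import Data.List.Relation.Binary.Subset.Propositional using (_⊆_)
open import Data.List.Relation.Unary.Unique.Propositional using (Unique)
open import Data.Nat using (ℕ; _*_; _^_; _<_)
open import Data.Product using (∃!; ∃-syntax; _×_)
open import Function.Bundles using (_⇔_)
open import Relation.Binary.PropositionalEquality using (_≡_; _≢_)

-- A 2-(v,k,1) design on the point set Fin v.  The block set is a finite set of
-- subsets, represented as a duplicate-free list whose order is irrelevant.
record Design (v k : ℕ) : Set where
  field
    1<k         : 1 < k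
    k<v         : k < v
    blocks      : List (Subset v)
    unique      : Unique blocks
    block-size  : ∀ {B} → B ∈ blocks → ∣ B ∣ ≡ k
    exactly-one : ∀ {x y : Fin v} → x ≢ y →
                  ∃! _≡_ (λ B → B ∈ blocks × x ∈ₛ B × y ∈ₛ B)

open Design public using (blocks)

-- As S is duplicate-free, its cardinality is length S.
record IsErdősKoRado {v k : ℕ} (D : Design v k) (S : List (Subset v)) : Set where
  field
    unique       : Unique S
    subset       : S ⊆ blocks D
    intersecting : ∀ {B C} → B ∈ S → C ∈ S → Nonempty (B ∩ C)

IsPointPencil : ∀ {v k} → Design v k → List (Subset v) → Set
IsPointPencil {v} D S = ∃[ p ] (∀ (B : Subset v) → B ∈ S ⇔ (B ∈ blocks D × p ∈ₛ B))

-- The real inequality c √n ≤ z for natural c, n and integer z: the left side is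
-- nonnegative, so it holds iff z is nonnegative and c² n ≤ z².
infix 4 _√_≤_
_√_≤_ : ℕ → ℕ → ℤ → Set
c √ n ≤ z = 0ℤ ℤ.≤ z × + (c ^ 2 * n) ℤ.≤ z ℤ.* z

-- r ≥ k² - 3k + (3/4) √k + 2, rearranged to 3 √k ≤ 4 (r - (k² - 3k + 2)).
LargeReplication : (r k : ℕ) → Set
LargeReplication r k =
  3 √ k ≤ (+ 4) ℤ.* (+ r ℤ.- ((+ k) ℤ.* (+ k) ℤ.- (+ 3) ℤ.* (+ k) ℤ.+ (+ 2)))

{-# OPTIONS --safe #-}

-- Write N = |S| and, for a point P, let w P be the number of blocks of S through P.
-- The squared distance from the characteristic vector of S to the row space of the incidence
-- matrix is a positive multiple of N (r - N) (r - k); since r > k this gives N ≤ r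
-- (Delsarte's clique bound), and N = r forces every block outside S to have
-- weight (sum of the w P over its points) exactly k.
--
-- Let N = r and suppose that no point is on all blocks of S. Then w ≤ k, and two points
-- not joined by a block of S satisfy w P + w Q ≤ k. Every block of S has weight
-- r + k - 1, and r ≥ k² - 3k + 4, so averaging yields a point P with w P = k; every
-- point of positive weight is then joined to P. For a point Q of weight 0 < c < k,
-- whose unjoined points have weight at most m, comparing the total weight
-- (r - c)(k - c) of these points with their number (k - 1)(k - c) gives
-- r - c ≤ m (k - 1). With m = k - c this shows c ≤ 2; but then m = 2 is admissible as
-- well, so r ≤ 2k, which leaves only (r , k) = (8 , 4). Otherwise all positive weights
-- equal k, and a block of S has weight k² = r + k - 1.
module Submission where

open import Defs
open import Data.Bool using (if_then_else_)
import Data.Bool.Properties as Bool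
open import Data.Empty using (⊥; ⊥-elim)
open import Data.Fin using (Fin; zero; suc; fromℕ<)
import Data.Fin.Properties as Fin
open import Data.Fin.Subset using (Subset; ∣_∣; inside; outside) renaming (_∈_ to _∈ₛ_; _∉_ to _∉ₛ_)
open import Data.Fin.Subset.Properties using (x∈p∩q⁻) renaming (_∈?_ to _∈ₛ?_)
import Data.Integer as ℤ
import Data.Integer.Properties as ℤ
open import Data.Integer.Tactic.RingSolver using (solve-∀)
open import Data.List using (List; []; _∷_; length; map; tabulate; allFin)
open import Data.List.Membership.Propositional using (_∈_; _∉_; find; lose)
open import Data.List.Membership.Propositional.Properties using (∈-allFin)
import Data.List.Membership.DecPropositional as DecMembership
open import Data.List.Properties using (length-tabulate; map-tabulate)
open import Data.List.Relation.Binary.Subset.Propositional using (_⊆_)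
import Data.List.Relation.Unary.All as All
open import Data.List.Relation.Unary.All.Properties using (¬All⇒Any¬)
open import Data.List.Relation.Unary.AllPairs using (_∷_)
import Data.List.Relation.Unary.Any as Any
open import Data.List.Relation.Unary.Any using (here; there)
open import Data.List.Relation.Unary.Unique.Propositional using (Unique)
open import Data.List.Relation.Unary.Unique.Propositional.Properties using (allFin⁺)
open import Data.Nat as ℕ using (ℕ; zero; suc; z≤n; s≤s; _∸_; _^_)
import Data.Nat.Properties as ℕ
open import Data.Product using (_×_; _,_; proj₁; proj₂; ∃-syntax)
open import Data.Sum using (_⊎_; inj₁; inj₂; reduce)
open import Data.Vec using ([]; _∷_)
import Data.Vec.Properties as Vec
open import Function using (_∘_; id)
open import Function.Bundles using (_⇔_; mk⇔; Equivalence)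
open import Relation.Binary.Definitions using (DecidableEquality)
open import Relation.Binary.PropositionalEquality
open import Relation.Nullary using (¬_; Dec; does; yes; no; contradiction)
open import Relation.Nullary.Decidable using (_×-dec_)

module Counting where
  open import Data.Integer using (ℤ; +_; -_; -[1+_]; +[1+_]; 0ℤ; 1ℤ; +≤+; _+_; _-_; _*_; _≤_)
  open ≡-Reasoning

  private
    variable
      A B : Set
      f g : A → ℤ

  -- Inequalities between integers.

  ≤-by : ∀ {a b c} → 0ℤ ≤ c → b - a ≡ c → a ≤ b
  ≤-by 0≤c eq = ℤ.0≤i-j⇒j≤i (subst (0ℤ ≤_) (sym eq) 0≤c)

  0≤+ : ∀ {a b} → 0ℤ ≤ a → 0ℤ ≤ b → 0ℤ ≤ a + b
  0≤+ = ℤ.+-mono-≤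

  0≤* : ∀ a b → 0ℤ ≤ a → 0ℤ ≤ b → 0ℤ ≤ a * b
  0≤* (+ m) (+ n) _ _ = subst (0ℤ ≤_) (ℤ.pos-* m n) (+≤+ z≤n)

  0≤² : ∀ a → 0ℤ ≤ a * a
  0≤² (+ n)    = 0≤* (+ n) (+ n) (+≤+ z≤n) (+≤+ z≤n)
  0≤² -[1+ n ] = +≤+ z≤n

  -- Contradictions between inequalities are certified by a sum of nonnegative terms
  -- that equals -1; a strict inequality a < b enters as 0 ≤ b - a - 1.  Abstract, since
  -- the injectivity check would otherwise evaluate the ring solver's proofs.
  abstract
    0≰-1 : ∀ {c} → 0ℤ ≤ c → c ≢ - 1ℤ
    0≰-1 () refl

  <⇒0≤ : ∀ {a b} → a ℤ.< b → 0ℤ ≤ b - a - 1ℤ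
  <⇒0≤ {a} {b} a<b = subst (0ℤ ≤_) (lemma a b) (ℤ.i≤j⇒0≤j-i (ℤ.i<j⇒i≤pred[j] a<b))
    where
    lemma : ∀ a b → - 1ℤ + b - a ≡ b - a - 1ℤ
    lemma = solve-∀

  ≤∧≢⇒0≤ : ∀ {a b} → a ≤ b → a ≢ b → 0ℤ ≤ b - a - 1ℤ
  ≤∧≢⇒0≤ a≤b a≢b = <⇒0≤ (ℤ.≤∧≢⇒< a≤b a≢b)

  0<* : ∀ a b → 0ℤ ≤ a - 1ℤ → 0ℤ ≤ b - 1ℤ → 0ℤ ≤ a * b - 1ℤ
  0<* a b 0<a 0<b = subst (0ℤ ≤_) (lemma a b) (0≤+ (0≤+ (0≤* (a - 1ℤ) (b - 1ℤ) 0<a 0<b) 0<a) 0<b)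
    where
    lemma : ∀ a b → (a - 1ℤ) * (b - 1ℤ) + (a - 1ℤ) + (b - 1ℤ) ≡ a * b - 1ℤ
    lemma = solve-∀

  0≤*⇒0≤ : ∀ a b → 0ℤ ≤ a - 1ℤ → 0ℤ ≤ a * b → 0ℤ ≤ b
  0≤*⇒0≤ a b 0<a 0≤ab with 0ℤ ℤ.≤? b
  ... | yes 0≤b = 0≤b
  ... | no ≰b   = ⊥-elim (0≰-1
    (0≤+ (0≤+ (0≤+ 0≤ab (0≤* (a - 1ℤ) (0ℤ - b - 1ℤ) 0<a 0<-b)) 0<a) 0<-b) (lemma a b))
    where
    0<-b : 0ℤ ≤ 0ℤ - b - 1ℤ
    0<-b = <⇒0≤ (ℤ.≰⇒> ≰b)
    lemma : ∀ a b → a * b + (a - 1ℤ) * (0ℤ - b - 1ℤ) + (a - 1ℤ) + (0ℤ - b - 1ℤ) ≡ - 1ℤ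
    lemma = solve-∀

  -- Sums over lists

  ∑ : List A → (A → ℤ) → ℤ
  ∑ []       f = 0ℤ
  ∑ (x ∷ xs) f = f x + ∑ xs f

  ∑-cong : ∀ (xs : List A) → (∀ {x} → x ∈ xs → f x ≡ g x) → ∑ xs f ≡ ∑ xs g
  ∑-cong []       eq = refl
  ∑-cong (x ∷ xs) eq = cong₂ _+_ (eq (here refl)) (∑-cong xs (eq ∘ there))

  ∑-mono : ∀ (xs : List A) → (∀ {x} → x ∈ xs → f x ≤ g x) → ∑ xs f ≤ ∑ xs g
  ∑-mono []       le = ℤ.≤-refl
  ∑-mono (x ∷ xs) le = ℤ.+-mono-≤ (le (here refl)) (∑-mono xs (le ∘ there))

  ∑-+ : ∀ (xs : List A) f g → ∑ xs (λ x → f x + g x) ≡ ∑ xs f + ∑ xs g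
  ∑-+ []       f g = refl
  ∑-+ (x ∷ xs) f g = trans (cong (_+_ (f x + g x)) (∑-+ xs f g)) (lemma (f x) (g x) (∑ xs f) (∑ xs g))
    where
    lemma : ∀ a b c d → a + b + (c + d) ≡ a + c + (b + d)
    lemma = solve-∀

  ∑-* : ∀ (xs : List A) c f → ∑ xs (λ x → c * f x) ≡ c * ∑ xs f
  ∑-* []       c f = sym (ℤ.*-zeroʳ c)
  ∑-* (x ∷ xs) c f = trans (cong (_+_ (c * f x)) (∑-* xs c f)) (sym (ℤ.*-distribˡ-+ c (f x) (∑ xs f)))

  ∑-*ʳ : ∀ (xs : List A) f c → ∑ xs (λ x → f x * c) ≡ ∑ xs f * c
  ∑-*ʳ xs f c = trans (∑-cong xs (λ {x} _ → ℤ.*-comm (f x) c)) (trans (∑-* xs c f) (ℤ.*-comm c _))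

  ∑-- : ∀ (xs : List A) f g → ∑ xs (λ x → f x - g x) ≡ ∑ xs f - ∑ xs g
  ∑-- []       f g = refl
  ∑-- (x ∷ xs) f g = trans (cong (_+_ (f x - g x)) (∑-- xs f g)) (lemma (f x) (g x) (∑ xs f) (∑ xs g))
    where
    lemma : ∀ a b c d → a - b + (c - d) ≡ a + c - (b + d)
    lemma = solve-∀

  ∑-const : ∀ (xs : List A) c → ∑ xs (λ _ → c) ≡ + length xs * c
  ∑-const []       c = refl
  ∑-const (x ∷ xs) c = trans (cong (_+_ c) (∑-const xs c)) (lemma c (+ length xs))
    where
    lemma : ∀ c n → c + n * c ≡ (1ℤ + n) * c
    lemma = solve-∀

  ∑-zero : ∀ (xs : List A) → (∀ {x} → x ∈ xs → f x ≡ 0ℤ) → ∑ xs f ≡ 0ℤ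
  ∑-zero xs eq = trans (∑-cong xs eq) (trans (∑-const xs 0ℤ) (ℤ.*-zeroʳ (+ length xs)))

  ∑-swap : ∀ (xs : List A) (ys : List B) (h : A → B → ℤ) →
           ∑ xs (λ x → ∑ ys (h x)) ≡ ∑ ys (λ y → ∑ xs (λ x → h x y))
  ∑-swap []       ys h = sym (∑-zero ys (λ _ → refl))
  ∑-swap (x ∷ xs) ys h =
    trans (cong (_+_ (∑ ys (h x))) (∑-swap xs ys h)) (sym (∑-+ ys (h x) _))

  0≤∑ : ∀ (xs : List A) → (∀ {x} → x ∈ xs → 0ℤ ≤ f x) → 0ℤ ≤ ∑ xs f
  0≤∑ []       0≤f = ℤ.≤-refl
  0≤∑ (x ∷ xs) 0≤f = 0≤+ (0≤f (here refl)) (0≤∑ xs (0≤f ∘ there))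

  ≤∑ : ∀ {A : Set} {xs : List A} {f x} → Unique xs → x ∈ xs →
       (∀ {y} → y ∈ xs → y ≢ x → 0ℤ ≤ f y) → f x ≤ ∑ xs f
  ≤∑ {xs = x ∷ xs} {f} (x∉ ∷ u) (here refl) 0≤f =
    ≤-by (0≤∑ xs (λ y∈ → 0≤f (there y∈) (λ { refl → All.lookup x∉ y∈ refl }))) (lemma (f x) (∑ xs f))
    where
    lemma : ∀ a b → a + b - a ≡ b
    lemma = solve-∀
  ≤∑ {xs = z ∷ xs} {f} {x} (z∉ ∷ u) (there x∈) 0≤f =
    ≤-by (0≤+ (0≤f (here refl) (All.lookup z∉ x∈)) (ℤ.i≤j⇒0≤j-i (≤∑ u x∈ (0≤f ∘ there))))
         (lemma (f x) (f z) (∑ xs f))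
    where
    lemma : ∀ a b c → b + c - a ≡ b + (c - a)
    lemma = solve-∀

  ∑≡0⇒≡0 : ∀ {A : Set} {xs : List A} {f x} → Unique xs → (∀ {y} → y ∈ xs → 0ℤ ≤ f y) →
           ∑ xs f ≡ 0ℤ → x ∈ xs → f x ≡ 0ℤ
  ∑≡0⇒≡0 {xs = xs} {f} u 0≤f eq x∈ =
    ℤ.≤-antisym (subst (f _ ≤_) eq (≤∑ u x∈ (λ y∈ _ → 0≤f y∈))) (0≤f x∈)

  -- Signs are required only away from `x` and `y`: in `R≤` the summand can be negative at one of
  -- the two points that are split off.
  pair≤∑ : ∀ {A : Set} {xs : List A} {f x y} → Unique xs → x ∈ xs → y ∈ xs → x ≢ y →
           (∀ {z} → z ∈ xs → z ≢ x → z ≢ y → 0ℤ ≤ f z) → f x + f y ≤ ∑ xs f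
  pair≤∑ u (here refl) (here refl) x≢y 0≤f = ⊥-elim (x≢y refl)
  pair≤∑ {f = f} {x} (x∉ ∷ u) (here refl) (there y∈) x≢y 0≤f =
    ℤ.+-monoʳ-≤ (f x) (≤∑ u y∈ (λ z∈ → 0≤f (there z∈) (λ { refl → All.lookup x∉ z∈ refl })))
  pair≤∑ {f = f} {x} {y} (y∉ ∷ u) (there x∈) (here refl) x≢y 0≤f =
    subst (_≤ _) (ℤ.+-comm (f y) (f x))
      (ℤ.+-monoʳ-≤ (f y) (≤∑ u x∈ (λ z∈ z≢x → 0≤f (there z∈) z≢x (λ { refl → All.lookup y∉ z∈ refl }))))
  pair≤∑ {xs = z ∷ xs} {f} {x} {y} (z∉ ∷ u) (there x∈) (there y∈) x≢y 0≤f =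
    subst (_≤ _) (ℤ.+-identityˡ _)
      (ℤ.+-mono-≤ (0≤f (here refl) (All.lookup z∉ x∈) (All.lookup z∉ y∈))
                  (pair≤∑ u x∈ y∈ x≢y (0≤f ∘ there)))

  -- Meant for row sums of matrices with constant entries off the diagonal: intersection sizes of
  -- blocks of a clique, and numbers of blocks through two points.
  ∑-except : ∀ {A : Set} {xs : List A} {f x} c → Unique xs → x ∈ xs →
             (∀ {y} → y ∈ xs → y ≢ x → f y ≡ c) → ∑ xs f ≡ f x + (+ length xs - 1ℤ) * c
  ∑-except {xs = x ∷ xs} {f} c (x∉ ∷ u) (here refl) eq =
    cong (_+_ (f x)) (trans (∑-cong xs (λ y∈ → eq (there y∈) (λ { refl → All.lookup x∉ y∈ refl })))
                  (trans (∑-const xs c) (cong (_* c) (lemma (+ length xs)))))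
    where
    lemma : ∀ a → a ≡ 1ℤ + a - 1ℤ
    lemma = solve-∀
  ∑-except {xs = z ∷ xs} {f} {x} c (z∉ ∷ u) (there x∈) eq =
    trans (cong₂ _+_ (eq (here refl) (All.lookup z∉ x∈)) (∑-except c u x∈ (eq ∘ there)))
          (lemma c (f x) (+ length xs))
    where
    lemma : ∀ c a n → c + (a + (n - 1ℤ) * c) ≡ a + (1ℤ + n - 1ℤ) * c
    lemma = solve-∀

  ∑-single : ∀ {A : Set} {xs : List A} {f x} → Unique xs → x ∈ xs →
             (∀ {y} → y ∈ xs → y ≢ x → f y ≡ 0ℤ) → ∑ xs f ≡ f x
  ∑-single {xs = xs} {f} {x} u x∈ eq =
    trans (∑-except 0ℤ u x∈ eq) (lemma (f x) (+ length xs))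
    where
    lemma : ∀ a n → a + (n - 1ℤ) * 0ℤ ≡ a
    lemma = solve-∀

  -- Sums with a sublist removed.

  module Removal {A : Set} (_≟_ : DecidableEquality A) where
    open DecMembership _≟_ using (_∈?_)

    infix 8 _∖_
    -- Zeroing terms instead of shortening the list keeps the sums indexed by the full block list.
    _∖_ : (A → ℤ) → List A → A → ℤ
    (f ∖ xs) y = if does (y ∈? xs) then 0ℤ else f y

    ∖≡0 : ∀ f xs {y} → (y ∉ xs → f y ≡ 0ℤ) → (f ∖ xs) y ≡ 0ℤ
    ∖≡0 f xs {y} f≡0 with y ∈? xs
    ... | yes _ = refl
    ... | no y∉ = f≡0 y∉

    ∖-∉ : ∀ f xs {y} → y ∉ xs → (f ∖ xs) y ≡ f y
    ∖-∉ f xs {y} y∉ with y ∈? xs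
    ... | yes y∈ = ⊥-elim (y∉ y∈)
    ... | no _   = refl

    0≤∖ : ∀ f xs {y} → 0ℤ ≤ f y → 0ℤ ≤ (f ∖ xs) y
    0≤∖ f xs {y} 0≤f with y ∈? xs
    ... | yes _ = ℤ.≤-refl
    ... | no _  = 0≤f

    -- The column sums of `δ` over `xs` are what removal subtracts; its row sums over `ys` are the
    -- values of `f` on `xs`. As both lists are duplicate-free, each of these sums has at most one
    -- nonzero term.
    ∑-∖ : ∀ f {xs ys} → Unique xs → Unique ys → xs ⊆ ys → ∑ ys (f ∖ xs) ≡ ∑ ys f - ∑ xs f
    ∑-∖ f {xs} {ys} xs! ys! xs⊆ys = begin
      ∑ ys (f ∖ xs)                              ≡⟨ ∑-cong ys (λ {y} _ → column y) ⟩
      ∑ ys (λ y → f y - ∑ xs (λ x → δ x y))      ≡⟨ ∑-- ys f _ ⟩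
      ∑ ys f - ∑ ys (λ y → ∑ xs (λ x → δ x y))   ≡⟨ cong (_-_ (∑ ys f)) (sym (∑-swap xs ys δ)) ⟩
      ∑ ys f - ∑ xs (λ x → ∑ ys (δ x))           ≡⟨ cong (_-_ (∑ ys f)) (∑-cong xs row) ⟩
      ∑ ys f - ∑ xs f                            ∎
      where
      δ : A → A → ℤ
      δ x y = if does (x ≟ y) then f y else 0ℤ
      δ-refl : ∀ x → δ x x ≡ f x
      δ-refl x with x ≟ x
      ... | yes _   = refl
      ... | no x≢x = ⊥-elim (x≢x refl)
      δ-≢ : ∀ {x y} → x ≢ y → δ x y ≡ 0ℤ
      δ-≢ {x} {y} x≢y with x ≟ y
      ... | yes x≡y = ⊥-elim (x≢y x≡y)
      ... | no _    = refl
      row : ∀ {x} → x ∈ xs → ∑ ys (δ x) ≡ f x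
      row {x} x∈ = trans (∑-single ys! (xs⊆ys x∈) (λ _ y≢x → δ-≢ (y≢x ∘ sym))) (δ-refl x)
      column : ∀ y → (f ∖ xs) y ≡ f y - ∑ xs (λ x → δ x y)
      column y with y ∈? xs
      ... | yes y∈ = sym (ℤ.i≡j⇒i-j≡0 (sym (trans (∑-single xs! y∈ (λ _ → δ-≢)) (δ-refl y))))
      ... | no y∉  = trans (sym (ℤ.+-identityʳ (f y)))
                       (cong (_-_ (f y)) (sym (∑-zero xs (λ x∈ → δ-≢ (λ { refl → y∉ x∈ })))))

  ∑-map : ∀ {A B : Set} (g : A → B) xs {f : B → ℤ} → ∑ (map g xs) f ≡ ∑ xs (f ∘ g)
  ∑-map g []       = refl
  ∑-map g (x ∷ xs) {f} = cong (_+_ (f (g x))) (∑-map g xs)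

  ∑-*∑ : ∀ {A B : Set} (xs : List A) (ys : List B) (a : A → ℤ) (b : A → B → ℤ) →
         ∑ xs (λ x → a x * ∑ ys (b x)) ≡ ∑ ys (λ y → ∑ xs (λ x → a x * b x y))
  ∑-*∑ xs ys a b = trans (∑-cong xs (λ {x} _ → sym (∑-* ys (a x) (b x)))) (∑-swap xs ys _)

  -- Indicators of subsets.

  module _ {v : ℕ} where

    ι : Subset v → Fin v → ℤ
    ι B P = if does (P ∈ₛ? B) then 1ℤ else 0ℤ

    ι-∈ : ∀ {B P} → P ∈ₛ B → ι B P ≡ 1ℤ
    ι-∈ {B} {P} P∈ with P ∈ₛ? B
    ... | yes _ = refl
    ... | no P∉ = ⊥-elim (P∉ P∈)

    ι-∉ : ∀ {B P} → P ∉ₛ B → ι B P ≡ 0ℤ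
    ι-∉ {B} {P} P∉ with P ∈ₛ? B
    ... | yes P∈ = ⊥-elim (P∉ P∈)
    ... | no _   = refl

    0≤ι : ∀ B P → 0ℤ ≤ ι B P
    0≤ι B P with P ∈ₛ? B
    ... | yes _ = +≤+ z≤n
    ... | no _  = +≤+ z≤n

    ιι≡1 : ∀ {B C P Q} → P ∈ₛ B → Q ∈ₛ C → ι B P * ι C Q ≡ 1ℤ
    ιι≡1 P∈ Q∈ = cong₂ _*_ (ι-∈ P∈) (ι-∈ Q∈)

    ιι≡0 : ∀ {B C P Q} → ¬ (P ∈ₛ B × Q ∈ₛ C) → ι B P * ι C Q ≡ 0ℤ
    ιι≡0 {B} {C} {P} {Q} ¬both with P ∈ₛ? B | Q ∈ₛ? C
    ... | yes P∈ | yes Q∈ = ⊥-elim (¬both (P∈ , Q∈))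
    ... | yes _  | no _   = refl
    ... | no _   | yes _  = refl
    ... | no _   | no _   = refl

    ι-idem : ∀ B P → ι B P * ι B P ≡ ι B P
    ι-idem B P with P ∈ₛ? B
    ... | yes _ = refl
    ... | no _  = refl

    ι-mono : ∀ {B P a b} → (P ∈ₛ B → a ≤ b) → ι B P * a ≤ ι B P * b
    ι-mono {B} {P} {a} {b} le with P ∈ₛ? B
    ... | yes P∈ = subst₂ _≤_ (sym (ℤ.*-identityˡ a)) (sym (ℤ.*-identityˡ b)) (le P∈)
    ... | no _   = ℤ.≤-refl

    -- With A the incidence matrix of points against `Bs`, this is the entry of A Aᵀ at `P`, `Q`.
    joint : List (Subset v) → Fin v → Fin v → ℤ
    joint Bs P Q = ∑ Bs (λ B → ι B P * ι B Q)

    -- Double counting of the pairs of a point `Q` and a block containing both `P` and `Q`, each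
    -- pair weighted by `a Q`. It is applied with `a` equal to 1, to `w` and to the indicator of a
    -- block.
    ∑-joint : ∀ Bs P (a : Fin v → ℤ) →
              ∑ (allFin v) (λ Q → a Q * joint Bs P Q) ≡
              ∑ Bs (λ B → ι B P * ∑ (allFin v) (λ Q → ι B Q * a Q))
    ∑-joint Bs P a = trans (∑-*∑ (allFin v) Bs a (λ Q B → ι B P * ι B Q)) (∑-cong Bs (λ {B} _ →
      trans (∑-cong (allFin v) (λ {Q} _ → lemma (a Q) (ι B P) (ι B Q)))
            (∑-* (allFin v) (ι B P) _)))
      where
      lemma : ∀ a b c → a * (b * c) ≡ b * (c * a)
      lemma = solve-∀

  ∑-ι : ∀ {v} (B : Subset v) → ∑ (allFin v) (ι B) ≡ + ∣ B ∣
  ∑-ι {zero}  []      = refl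
  ∑-ι {suc v} (s ∷ B) = trans (cong (_+_ (ι (s ∷ B) zero)) tail) (head s)
    where
    tail : ∑ (tabulate suc) (ι (s ∷ B)) ≡ + ∣ B ∣
    tail = trans (cong (λ xs → ∑ xs (ι (s ∷ B))) (sym (map-tabulate id suc)))
                 (trans (∑-map suc (allFin v)) (∑-ι B))
    head : ∀ s → ι (s ∷ B) zero + + ∣ B ∣ ≡ + ∣ s ∷ B ∣
    head inside  = refl
    head outside = refl

  -- Arithmetic of the parameters.

  pred-eq : ∀ {r k v} → 1 ℕ.< k → k ℕ.< v → r ℕ.* (k ∸ 1) ≡ v ∸ 1 → + r * (+ k - 1ℤ) ≡ + v - 1ℤ
  pred-eq {r} {suc k} {suc v} _ _ eq = trans (sym (ℤ.pos-* r k)) (cong +_ eq)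

  pred-cancel : ∀ {k} → 1 ℕ.< k → ∀ {a b} → (+ k - 1ℤ) * a ≡ (+ k - 1ℤ) * b → a ≡ b
  pred-cancel {suc (suc k)} _ = ℤ.*-cancelˡ-≡ +[1+ k ] _ _
  pred-cancel {suc zero} (s≤s ())

  -- As `k` is at least 4, 3 √k is at least 6, so 4 e ≥ 6 and the integer `e` is at least 2. For e =
  -- r - (k² - 3k + 2) this replaces the square root by r ≥ k² - 3k + 4.
  excess≥2 : ∀ {k} e → 4 ℕ.≤ k → 3 √ k ≤ + 4 * e → + 2 ≤ e
  excess≥2 (+ suc (suc e)) _ _ = +≤+ (s≤s (s≤s z≤n))
  excess≥2 {k} (+ 0) 4≤k (_ , +≤+ le) = ⊥-elim (ℕ.<⇒≱ (s≤s z≤n) (ℕ.≤-trans (ℕ.*-monoʳ-≤ 9 4≤k) le))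
  -- After squaring, e = 1 would give 36 ≤ 9 k ≤ 16, against 17 ≤ 17 + 19 = 36.
  excess≥2 {k} (+ 1) 4≤k (_ , +≤+ le) = ⊥-elim (ℕ.<⇒≱ (ℕ.m≤m+n 17 19) (ℕ.≤-trans (ℕ.*-monoʳ-≤ 9 4≤k) le))
  excess≥2 -[1+ _ ] _ (() , _)

  large⇒ : ∀ {r k} → 4 ℕ.≤ k → LargeReplication r k → 0ℤ ≤ + r - (+ k * + k - + 3 * + k + + 4)
  large⇒ {r} {k} 4≤k large = subst (0ℤ ≤_) (l (+ r) (+ k)) (ℤ.i≤j⇒0≤j-i (excess≥2 _ 4≤k large))
    where
    l : ∀ r k → r - (k * k - + 3 * k + + 2) - + 2 ≡ r - (k * k - + 3 * k + + 4)
    l = solve-∀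

  pos-k²-k+1 : ∀ k → 1 ℕ.≤ k → + k * + k - + k + 1ℤ ≡ + (k ^ 2 ∸ k ℕ.+ 1)
  pos-k²-k+1 k@(suc _) _ = begin
    + k * + k - + k + 1ℤ        ≡⟨ cong (λ a → a - + k + 1ℤ) (sym (ℤ.pos-* k k)) ⟩
    + (k ℕ.* k) - + k + 1ℤ      ≡⟨ cong (_+ 1ℤ) (ℤ.m-n≡m⊖n (k ℕ.* k) k) ⟩
    (k ℕ.* k) ℤ.⊖ k + 1ℤ        ≡⟨ cong (_+ 1ℤ) (ℤ.⊖-≥ (ℕ.m≤m*n k k)) ⟩
    + (k ℕ.* k ∸ k ℕ.+ 1)       ≡⟨ cong (λ a → + (k ℕ.* a ∸ k ℕ.+ 1)) (sym (ℕ.*-identityʳ k)) ⟩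
    + (k ^ 2 ∸ k ℕ.+ 1)         ∎

  -- If n > r, then n, u = n (r - k) + r (k - 1) and r - k are all positive, and the factor r - n
  -- makes the product negative.
  delsarte-arithmetic : ∀ n r k → 0ℤ ≤ r → 0ℤ ≤ k - 1ℤ → 0ℤ ≤ r - k - 1ℤ →
    0ℤ ≤ n * (r * (n + k - 1ℤ) - k * n) * ((r - n) * (r - k)) → n ≤ r
  delsarte-arithmetic n r k 0≤r 0<k 0<r-k 0≤p with n ℤ.≤? r
  ... | yes n≤r = n≤r
  ... | no n≰r  = ⊥-elim (0≰-1
    (0≤+ 0≤p (0<* n _ 0<n (0<* u _ 0<u (0<* (n - r) (r - k) 0<n-r 0<r-k)))) (lemma n u r k))
    where
    u : ℤ
    u = r * (n + k - 1ℤ) - k * n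
    0<n-r : 0ℤ ≤ n - r - 1ℤ
    0<n-r = <⇒0≤ (ℤ.≰⇒> n≰r)
    0<n : 0ℤ ≤ n - 1ℤ
    0<n = subst (0ℤ ≤_) (l n r) (0≤+ 0<n-r 0≤r)
      where
      l : ∀ n r → n - r - 1ℤ + r ≡ n - 1ℤ
      l = solve-∀
    0<u : 0ℤ ≤ u - 1ℤ
    0<u = subst (0ℤ ≤_) (l n r k) (0≤+ (0<* n (r - k) 0<n 0<r-k) (0≤* r (k - 1ℤ) 0≤r 0<k))
      where
      l : ∀ n r k → n * (r - k) - 1ℤ + r * (k - 1ℤ) ≡ r * (n + k - 1ℤ) - k * n - 1ℤ
      l = solve-∀
    lemma : ∀ n u r k → n * u * ((r - n) * (r - k)) + (n * (u * ((n - r) * (r - k))) - 1ℤ) ≡ - 1ℤ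
    lemma = solve-∀

  -- Weights and the clique bound

  module DesignCounts {v k r : ℕ} (D : Design v k) (r-eq : r ℕ.* (k ∸ 1) ≡ v ∸ 1) where
    open Design D using (1<k; k<v; exactly-one; block-size) renaming (unique to blocks!)

    points : List (Fin v)
    points = allFin v

    points! : Unique points
    points! = allFin⁺ v

    -- Abstract, so that products of these numbers stay folded during unification.
    abstract
      K R V : ℤ
      K = + k
      R = + r
      V = + v

      +k≡K : + k ≡ K
      +k≡K = refl

      +r≡R : + r ≡ R
      +r≡R = refl

      length-points : + length points ≡ V
      length-points = cong +_ (length-tabulate {n = v} id)

      R[K-1]≡V-1 : R * (K - 1ℤ) ≡ V - 1ℤ
      R[K-1]≡V-1 = pred-eq {r} 1<k k<v r-eq

      K-1-cancel : ∀ {a b} → (K - 1ℤ) * a ≡ (K - 1ℤ) * b → a ≡ b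
      K-1-cancel = pred-cancel 1<k

      0≤K : 0ℤ ≤ K
      0≤K = +≤+ z≤n

      0≤R : 0ℤ ≤ R
      0≤R = +≤+ z≤n

      4≤K : 4 ℕ.≤ k → + 4 ≤ K
      4≤K = +≤+

      K²-3K+4≤R : 4 ℕ.≤ k → LargeReplication r k → 0ℤ ≤ R - (K * K - + 3 * K + + 4)
      K²-3K+4≤R = large⇒ {r} {k}

    ∑-const-points : ∀ c → ∑ points (λ _ → c) ≡ V * c
    ∑-const-points c = trans (∑-const points c) (cong (_* c) length-points)

    ∑-block : ∀ {B} → B ∈ blocks D → ∑ points (ι B) ≡ K
    ∑-block {B} B∈ = trans (∑-ι B) (trans (cong +_ (block-size B∈)) +k≡K)

    ∑-block-*1 : ∀ {B} → B ∈ blocks D → ∑ points (λ P → ι B P * 1ℤ) ≡ K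
    ∑-block-*1 {B} B∈ = trans (∑-*ʳ points (ι B) 1ℤ) (trans (ℤ.*-identityʳ _) (∑-block B∈))

    block-≡ : ∀ {B C P Q} → B ∈ blocks D → C ∈ blocks D → P ≢ Q →
              P ∈ₛ B → Q ∈ₛ B → P ∈ₛ C → Q ∈ₛ C → B ≡ C
    block-≡ B∈ C∈ P≢Q P∈B Q∈B P∈C Q∈C with exactly-one P≢Q
    ... | _ , _ , only = trans (sym (only (B∈ , P∈B , Q∈B))) (only (C∈ , P∈C , Q∈C))

    joint-blocks : ∀ {P Q} → P ≢ Q → joint (blocks D) P Q ≡ 1ℤ
    joint-blocks P≢Q with exactly-one P≢Q
    ... | B , (B∈ , P∈ , Q∈) , only =
      trans (∑-single blocks! B∈ (λ C∈ C≢B → ιι≡0 (λ { (P∈C , Q∈C) → C≢B (sym (only (C∈ , P∈C , Q∈C))) })))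
            (ιι≡1 P∈ Q∈)

    -- Let d blocks pass through `P`. Their incidences with points number d K; `P` accounts for d of
    -- them and every other point for exactly one. So (K - 1) d = V - 1 = (K - 1) R.
    degree : ∀ P → ∑ (blocks D) (λ B → ι B P) ≡ R
    degree P = K-1-cancel (begin
      (K - 1ℤ) * d
        ≡⟨ lemma₁ K d ⟩
      d * K - d
        ≡⟨ cong (_- d) (sym (∑-*ʳ (blocks D) _ K)) ⟩
      ∑ (blocks D) (λ B → ι B P * K) - d
        ≡⟨ cong (_- d) (∑-cong (blocks D) (λ {B} B∈ → cong (ι B P *_) (sym (∑-block-*1 B∈)))) ⟩
      ∑ (blocks D) (λ B → ι B P * ∑ points (λ Q → ι B Q * 1ℤ)) - d
        ≡⟨ cong (_- d) (sym (∑-joint (blocks D) P (λ _ → 1ℤ))) ⟩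
      ∑ points (λ Q → 1ℤ * joint (blocks D) P Q) - d
        ≡⟨ cong (_- d) (∑-except 1ℤ points! (∈-allFin P)
             (λ {Q} _ Q≢P → cong (1ℤ *_) (joint-blocks (Q≢P ∘ sym)))) ⟩
      1ℤ * joint (blocks D) P P + (+ length points - 1ℤ) * 1ℤ - d
        ≡⟨ cong₂ (λ j n → 1ℤ * j + (n - 1ℤ) * 1ℤ - d)
             (∑-cong (blocks D) (λ {B} _ → ι-idem B P)) length-points ⟩
      1ℤ * d + (V - 1ℤ) * 1ℤ - d
        ≡⟨ lemma₂ d V ⟩
      V - 1ℤ
        ≡⟨ sym R[K-1]≡V-1 ⟩
      R * (K - 1ℤ)
        ≡⟨ ℤ.*-comm R _ ⟩
      (K - 1ℤ) * R ∎)
      where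
      d : ℤ
      d = ∑ (blocks D) (λ B → ι B P)
      lemma₁ : ∀ k d → (k - 1ℤ) * d ≡ d * k - d
      lemma₁ = solve-∀
      lemma₂ : ∀ d v → 1ℤ * d + (v - 1ℤ) * 1ℤ - d ≡ v - 1ℤ
      lemma₂ = solve-∀

    joint-self : ∀ P → joint (blocks D) P P ≡ R
    joint-self P = trans (∑-cong (blocks D) (λ {B} _ → ι-idem B P)) (degree P)

    block-count : + length (blocks D) * K ≡ V * R
    block-count = begin
      + length (blocks D) * K                      ≡⟨ sym (∑-const (blocks D) K) ⟩
      ∑ (blocks D) (λ _ → K)                       ≡⟨ ∑-cong (blocks D) (λ B∈ → sym (∑-block B∈)) ⟩
      ∑ (blocks D) (λ B → ∑ points (ι B))          ≡⟨ ∑-swap (blocks D) points ι ⟩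
      ∑ points (λ P → ∑ (blocks D) (λ B → ι B P))  ≡⟨ ∑-cong points (λ {P} _ → degree P) ⟩
      ∑ points (λ _ → R)                           ≡⟨ ∑-const-points R ⟩
      V * R                                        ∎

    module Intersecting {S : List (Subset v)} (ekr : IsErdősKoRado D S) where
      open IsErdősKoRado ekr renaming (unique to S!)

      abstract
        N : ℤ
        N = + length S

        +length≡N : + length S ≡ N
        +length≡N = refl

      ∑-const-S : ∀ c → ∑ S (λ _ → c) ≡ N * c
      ∑-const-S c = trans (∑-const S c) (cong (_* c) +length≡N)

      w : Fin v → ℤ
      w P = ∑ S (λ B → ι B P)

      -- Interchanging sums gives the sum of |B ∩ C| over the blocks B of `S`. With A the incidence
      -- matrix of the design and χ the characteristic vector of `S`, `w` is A χ, and on blocks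
      -- `weight` is Aᵀ A χ.
      weight : Subset v → ℤ
      weight C = ∑ points (λ P → ι C P * w P)

      0≤w : ∀ P → 0ℤ ≤ w P
      0≤w P = 0≤∑ S (λ {B} _ → 0≤ι B P)

      ∑w : ∑ points w ≡ N * K
      ∑w = trans (∑-swap points S _)
            (trans (∑-cong S (λ B∈ → ∑-block (subset B∈))) (∑-const-S K))

      meet-self : ∀ {B} → B ∈ S → ∑ points (λ P → ι B P * ι B P) ≡ K
      meet-self {B} B∈ = trans (∑-cong points (λ {P} _ → ι-idem B P)) (∑-block (subset B∈))

      meet : ∀ {B C} → B ∈ S → C ∈ S → B ≢ C → ∑ points (λ P → ι B P * ι C P) ≡ 1ℤ
      meet {B} {C} B∈ C∈ B≢C with intersecting B∈ C∈
      ... | P , P∈ with x∈p∩q⁻ B C P∈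
      ... | P∈B , P∈C =
        trans (∑-single points! (∈-allFin P) (λ {Q} _ Q≢P → ιι≡0 (λ { (Q∈B , Q∈C) →
                 B≢C (block-≡ (subset B∈) (subset C∈) Q≢P Q∈B P∈B Q∈C P∈C) })))
              (ιι≡1 P∈B P∈C)

      -- `B` meets itself in K points and each of the other N - 1 blocks of `S` in exactly one.
      weight-S : ∀ {B} → B ∈ S → weight B ≡ N + K - 1ℤ
      weight-S {B} B∈ = begin
        weight B
          ≡⟨ ∑-*∑ points S (ι B) _ ⟩
        ∑ S (λ C → ∑ points (λ P → ι B P * ι C P))
          ≡⟨ ∑-except 1ℤ S! B∈ (λ C∈ C≢B → meet B∈ C∈ (C≢B ∘ sym)) ⟩
        ∑ points (λ P → ι B P * ι B P) + (+ length S - 1ℤ) * 1ℤ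
          ≡⟨ cong₂ (λ a n → a + (n - 1ℤ) * 1ℤ) (meet-self B∈) +length≡N ⟩
        K + (N - 1ℤ) * 1ℤ
          ≡⟨ lemma K N ⟩
        N + K - 1ℤ ∎
        where
        lemma : ∀ k n → k + (n - 1ℤ) * 1ℤ ≡ n + k - 1ℤ
        lemma = solve-∀

      -- The squared norm of A χ is the inner product of χ with Aᵀ A χ, that is, the sum of the
      -- weights of the blocks of `S`.
      ∑w² : ∑ points (λ P → w P * w P) ≡ N * (N + K - 1ℤ)
      ∑w² = trans (∑-*∑ points S w _)
            (trans (∑-cong S (λ {B} B∈ → trans (∑-cong points (λ {P} _ → ℤ.*-comm (w P) (ι B P))) (weight-S B∈)))
                   (∑-const-S _))

      ∑weight : ∑ (blocks D) weight ≡ R * (N * K)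
      ∑weight = begin
        ∑ (blocks D) weight
          ≡⟨ ∑-swap (blocks D) points _ ⟩
        ∑ points (λ P → ∑ (blocks D) (λ C → ι C P * w P))
          ≡⟨ ∑-cong points (λ {P} _ → trans (∑-*ʳ (blocks D) _ (w P)) (cong (_* w P) (degree P))) ⟩
        ∑ points (λ P → R * w P)
          ≡⟨ ∑-* points R w ⟩
        R * ∑ points w
          ≡⟨ cong (R *_) ∑w ⟩
        R * (N * K) ∎

      -- The entry at `P` of A Aᵀ w, where A Aᵀ = (R - 1) I + J for a design, J being the all-one
      -- matrix.
      ∑ι-weight : ∀ P → ∑ (blocks D) (λ C → ι C P * weight C) ≡ N * K + (R - 1ℤ) * w P
      ∑ι-weight P = begin
        ∑ (blocks D) (λ C → ι C P * weight C)       ≡⟨ sym (∑-joint (blocks D) P w) ⟩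
        ∑ points (λ Q → w Q * M Q)                  ≡⟨ ∑-cong points (λ {Q} _ → lemma (w Q) (M Q)) ⟩
        ∑ points (λ Q → w Q + w Q * (M Q - 1ℤ))     ≡⟨ ∑-+ points w _ ⟩
        ∑ points w + ∑ points (λ Q → w Q * (M Q - 1ℤ))
          ≡⟨ cong₂ _+_ ∑w (∑-single points! (∈-allFin P) (λ {Q} _ Q≢P →
               trans (cong (λ j → w Q * (j - 1ℤ)) (joint-blocks (Q≢P ∘ sym))) (ℤ.*-zeroʳ (w Q)))) ⟩
        N * K + w P * (M P - 1ℤ)                    ≡⟨ cong (λ j → N * K + w P * (j - 1ℤ)) (joint-self P) ⟩
        N * K + w P * (R - 1ℤ)                      ≡⟨ cong (_+_ (N * K)) (ℤ.*-comm (w P) _) ⟩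
        N * K + (R - 1ℤ) * w P                      ∎
        where
        M : Fin v → ℤ
        M = joint (blocks D) P
        lemma : ∀ a j → a * j ≡ a + a * (j - 1ℤ)
        lemma = solve-∀

      -- The quadratic form of A Aᵀ = J + (R - 1) I at `w`: the square of the sum of `w`, plus R - 1
      -- times the sum of its squares.
      ∑weight² : ∑ (blocks D) (λ C → weight C * weight C) ≡ N * K * (N * K) + (R - 1ℤ) * (N * (N + K - 1ℤ))
      ∑weight² = begin
        ∑ (blocks D) (λ C → weight C * weight C)
          ≡⟨ ∑-*∑ (blocks D) points weight _ ⟩
        ∑ points (λ P → ∑ (blocks D) (λ C → weight C * (ι C P * w P)))
          ≡⟨ ∑-cong points (λ {P} _ → trans (∑-cong (blocks D) (λ {C} _ → lemma₁ (weight C) (ι C P) (w P)))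
               (trans (∑-* (blocks D) (w P) _) (cong (w P *_) (∑ι-weight P)))) ⟩
        ∑ points (λ P → w P * (N * K + (R - 1ℤ) * w P))
          ≡⟨ ∑-cong points (λ {P} _ → lemma₂ (w P) (N * K) (R - 1ℤ)) ⟩
        ∑ points (λ P → N * K * w P + (R - 1ℤ) * (w P * w P))
          ≡⟨ ∑-+ points _ _ ⟩
        ∑ points (λ P → N * K * w P) + ∑ points (λ P → (R - 1ℤ) * (w P * w P))
          ≡⟨ cong₂ _+_ (trans (∑-* points (N * K) w) (cong (N * K *_) ∑w))
                       (trans (∑-* points (R - 1ℤ) _) (cong ((R - 1ℤ) *_) ∑w²)) ⟩
        N * K * (N * K) + (R - 1ℤ) * (N * (N + K - 1ℤ))  ∎
        where
        lemma₁ : ∀ a b c → a * (b * c) ≡ c * (b * a)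
        lemma₁ = solve-∀
        lemma₂ : ∀ a b c → a * (b + c * a) ≡ b * a + c * (a * a)
        lemma₂ = solve-∀

      -- z is R (R - 1) times the projection of the characteristic vector of S
      -- onto the row space of the incidence matrix.
      z : Subset v → ℤ
      z C = R * weight C - K * N

      open DecMembership (Vec.≡-dec {n = v} Bool._≟_) using (_∈?_)
      open Removal (Vec.≡-dec {n = v} Bool._≟_)

      U : ℤ
      U = R * (N + K - 1ℤ) - K * N

      z-S : ∀ {B} → B ∈ S → z B ≡ U
      z-S B∈ = cong (λ a → R * a - K * N) (weight-S B∈)

      ∑z² : ∑ (blocks D) (λ C → z C * z C) ≡
            R * R * (N * K * (N * K) + (R - 1ℤ) * (N * (N + K - 1ℤ)))
              - + 2 * R * K * N * (R * (N * K)) + K * N * N * (V * R)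
      ∑z² = begin
        ∑ (blocks D) (λ C → z C * z C)
          ≡⟨ ∑-cong (blocks D) (λ {C} _ → lemma₁ R (weight C) K N) ⟩
        ∑ (blocks D) (λ C → R * R * (weight C * weight C) - + 2 * R * K * N * weight C + K * N * N * K)
          ≡⟨ ∑-+ (blocks D) _ _ ⟩
        ∑ (blocks D) (λ C → R * R * (weight C * weight C) - + 2 * R * K * N * weight C)
          + ∑ (blocks D) (λ C → K * N * N * K)
          ≡⟨ cong₂ _+_ (trans (∑-- (blocks D) _ _)
               (cong₂ _-_ (trans (∑-* (blocks D) (R * R) _) (cong (R * R *_) ∑weight²))
                          (trans (∑-* (blocks D) (+ 2 * R * K * N) weight) (cong (+ 2 * R * K * N *_) ∑weight))))
               (trans (∑-const (blocks D) _)
                 (trans (lemma₂ (+ length (blocks D)) K N) (cong (K * N * N *_) block-count))) ⟩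
        _ ∎
        where
        lemma₁ : ∀ r f k n → (r * f - k * n) * (r * f - k * n) ≡
                 r * r * (f * f) - + 2 * r * k * n * f + k * n * n * k
        lemma₁ = solve-∀
        lemma₂ : ∀ b k n → b * (k * n * n * k) ≡ k * n * n * (b * k)
        lemma₂ = solve-∀

      -- Conceptually, `z` is R (R - 1) times an orthogonal projection of χ, so its squared norm is
      -- R (R - 1) times its sum N U over `S`. Removing the part N U² on `S` leaves N U (R (R - 1) -
      -- U), and the last factor is (R - N) (R - K). The proof expands the moments instead and
      -- eliminates V.
      ∑-outside : ∑ (blocks D) ((λ C → z C * z C) ∖ S) ≡ N * U * ((R - N) * (R - K))
      ∑-outside = begin
        ∑ (blocks D) ((λ C → z C * z C) ∖ S)
          ≡⟨ ∑-∖ (λ C → z C * z C) S! blocks! subset ⟩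
        ∑ (blocks D) (λ C → z C * z C) - ∑ S (λ C → z C * z C)
          ≡⟨ cong₂ _-_ (trans ∑z² (cong (λ x → R * R * (N * K * (N * K) + (R - 1ℤ) * (N * (N + K - 1ℤ)))
                                   - + 2 * R * K * N * (R * (N * K)) + K * N * N * (x * R)) V≡))
               (trans (∑-cong S (λ B∈ → cong₂ _*_ (z-S B∈) (z-S B∈))) (∑-const-S (U * U))) ⟩
        _ ≡⟨ lemma R N K ⟩
        N * U * ((R - N) * (R - K)) ∎
        where
        V≡ : V ≡ R * (K - 1ℤ) + 1ℤ
        V≡ = trans (l V) (cong (_+ 1ℤ) (sym R[K-1]≡V-1))
          where
          l : ∀ x → x ≡ x - 1ℤ + 1ℤ
          l = solve-∀
        lemma : ∀ R N K →
          R * R * (N * K * (N * K) + (R - 1ℤ) * (N * (N + K - 1ℤ)))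
            - + 2 * R * K * N * (R * (N * K)) + K * N * N * ((R * (K - 1ℤ) + 1ℤ) * R)
            - N * ((R * (N + K - 1ℤ) - K * N) * (R * (N + K - 1ℤ) - K * N))
          ≡ N * (R * (N + K - 1ℤ) - K * N) * ((R - N) * (R - K))
        lemma = solve-∀

      -- All N blocks of `S` are among the R blocks through `P`. For a pencil none remain outside,
      -- which gives N = R; conversely N = R leaves none, which makes `S` a pencil.
      ∑-off-S : ∀ {P} → (∀ {B} → B ∈ S → P ∈ₛ B) → ∑ (blocks D) ((λ C → ι C P) ∖ S) ≡ R - N
      ∑-off-S {P} all∋P = trans (∑-∖ (λ C → ι C P) S! blocks! subset)
        (cong₂ _-_ (degree P) (trans (∑-cong S (λ B∈ → ι-∈ (all∋P B∈))) (trans (∑-const-S 1ℤ) (ℤ.*-identityʳ N))))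

      pencil⇒N≡R : IsPointPencil D S → N ≡ R
      pencil⇒N≡R (P , mem) = sym (ℤ.i-j≡0⇒i≡j R N
        (trans (sym (∑-off-S (λ {B} B∈ → proj₂ (Equivalence.to (mem B) B∈))))
          (∑-zero (blocks D) (λ {C} C∈ → ∖≡0 (λ C → ι C P) S
            (λ C∉S → ι-∉ (λ P∈C → C∉S (Equivalence.from (mem C) (C∈ , P∈C))))))))

      common⇒pencil : ∀ {P} → N ≡ R → (∀ {B} → B ∈ S → P ∈ₛ B) → IsPointPencil D S
      common⇒pencil {P} N≡R all∋P =
        P , λ B → mk⇔ (λ B∈ → subset B∈ , all∋P B∈) (λ { (B∈ , P∈B) → in-S B∈ P∈B })
        where
        in-S : ∀ {B} → B ∈ blocks D → P ∈ₛ B → B ∈ S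
        in-S {B} B∈ P∈B with B ∈? S
        ... | yes B∈S = B∈S
        -- A block through `P` outside `S` would contribute 1 to a sum of nonnegative terms equal to
        -- R - N = 0.
        ... | no B∉S  = contradiction
          (trans (sym (ι-∈ P∈B)) (trans (sym (∖-∉ (λ C → ι C P) S B∉S))
            (∑≡0⇒≡0 blocks! (λ {C} _ → 0≤∖ (λ C → ι C P) S (0≤ι C P))
              (trans (∑-off-S all∋P) (ℤ.i≡j⇒i-j≡0 (sym N≡R))) B∈)))
          (λ ())

      -- Points joined by blocks of the clique.

      Unjoined : Fin v → Fin v → Set
      Unjoined P Q = ∀ {B} → B ∈ S → ¬ (P ∈ₛ B × Q ∈ₛ B)

      joint-cases : ∀ P Q → P ≢ Q →
        (∃[ B ] (B ∈ S × P ∈ₛ B × Q ∈ₛ B) × joint S P Q ≡ 1ℤ) ⊎ (Unjoined P Q × joint S P Q ≡ 0ℤ)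
      joint-cases P Q P≢Q with Any.any? (λ B → (P ∈ₛ? B) ×-dec (Q ∈ₛ? B)) S
      ... | yes any with find any
      ...   | B , B∈ , P∈ , Q∈ = inj₁ (B , (B∈ , P∈ , Q∈) ,
        trans (∑-single S! B∈ (λ C∈ C≢B → ιι≡0 (λ { (P∈C , Q∈C) →
                 C≢B (block-≡ (subset C∈) (subset B∈) P≢Q P∈C Q∈C P∈ Q∈) })))
              (ιι≡1 P∈ Q∈))
      joint-cases P Q P≢Q | no none = inj₂ (unj , ∑-zero S (λ B∈ → ιι≡0 (unj B∈)))
        where
        unj : Unjoined P Q
        unj B∈ both = none (lose B∈ both)

      joint≤1 : ∀ P Q → P ≢ Q → joint S P Q ≤ 1ℤ
      joint≤1 P Q P≢Q with joint-cases P Q P≢Q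
      ... | inj₁ (_ , _ , eq) = ℤ.≤-reflexive eq
      ... | inj₂ (_ , eq)     = subst (_≤ 1ℤ) (sym eq) (+≤+ z≤n)

      joint-refl : ∀ P → joint S P P ≡ w P
      joint-refl P = ∑-cong S (λ {B} _ → ι-idem B P)

      w≥1 : ∀ {B P} → B ∈ S → P ∈ₛ B → 0ℤ ≤ w P - 1ℤ
      w≥1 {B} {P} B∈ P∈ = ℤ.i≤j⇒0≤j-i (subst (_≤ w P) (ι-∈ P∈) (≤∑ S! B∈ (λ {C} _ _ → 0≤ι C P)))

      ∑-joint-S : ∀ P → ∑ points (joint S P) ≡ w P * K
      ∑-joint-S P = begin
        ∑ points (joint S P)
          ≡⟨ ∑-cong points (λ {Q} _ → sym (ℤ.*-identityˡ (joint S P Q))) ⟩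
        ∑ points (λ Q → 1ℤ * joint S P Q)
          ≡⟨ ∑-joint S P (λ _ → 1ℤ) ⟩
        ∑ S (λ B → ι B P * ∑ points (λ Q → ι B Q * 1ℤ))
          ≡⟨ ∑-cong S (λ {B} B∈ → cong (ι B P *_) (∑-block-*1 (subset B∈))) ⟩
        ∑ S (λ B → ι B P * K)
          ≡⟨ ∑-*ʳ S (λ B → ι B P) K ⟩
        w P * K ∎

      ∑-w-joint : ∀ P → ∑ points (λ Q → w Q * joint S P Q) ≡ w P * (N + K - 1ℤ)
      ∑-w-joint P = trans (∑-joint S P w)
        (trans (∑-cong S (λ {B} B∈ → cong (ι B P *_) (weight-S B∈))) (∑-*ʳ S (λ B → ι B P) _))

      -- Every block of `S` through `P` differs from `B`, hence meets it in exactly one point.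
      ∑-line-joint : ∀ {B P} → B ∈ S → P ∉ₛ B → ∑ points (λ Q → ι B Q * joint S P Q) ≡ w P
      ∑-line-joint {B} {P} B∈ P∉ = trans (∑-joint S P (ι B)) (∑-cong S term)
        where
        term : ∀ {C} → C ∈ S → ι C P * ∑ points (λ Q → ι C Q * ι B Q) ≡ ι C P
        term {C} C∈ with P ∈ₛ? C
        ... | yes P∈ = trans (ℤ.*-identityˡ _) (meet C∈ B∈ (λ { refl → P∉ P∈ }))
        ... | no _   = refl

      -- The blocks of `S` through `P` meet `B` in different points, since a point other than `P`
      -- shares at most one block with `P`.
      w≤K : ∀ {B P} → B ∈ S → P ∉ₛ B → w P ≤ K
      w≤K {B} {P} B∈ P∉ = subst₂ _≤_ (∑-line-joint B∈ P∉)
        (∑-block-*1 (subset B∈))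
        (∑-mono points (λ {Q} _ → ι-mono {B = B} {P = Q} (λ Q∈ → joint≤1 P Q (λ { refl → P∉ Q∈ }))))

      module Large (4≤k : 4 ℕ.≤ k) (large : 0ℤ ≤ R - (K * K - + 3 * K + + 4)) where

        0≤K-4 : 0ℤ ≤ K - + 4
        0≤K-4 = ℤ.i≤j⇒0≤j-i (4≤K 4≤k)

        0≤K-1 : 0ℤ ≤ K - 1ℤ
        0≤K-1 = ℤ.i≤j⇒0≤j-i (ℤ.≤-trans (+≤+ (s≤s z≤n)) (4≤K 4≤k))

        0≤R-K-1 : 0ℤ ≤ R - K - 1ℤ
        0≤R-K-1 = subst (0ℤ ≤_) (lemma R K) (0≤+ (0≤+ large (0≤* K (K - + 4) 0≤K 0≤K-4)) (+≤+ {n = 3} z≤n))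
          where
          lemma : ∀ r k → r - (k * k - + 3 * k + + 4) + k * (k - + 4) + + 3 ≡ r - k - 1ℤ
          lemma = solve-∀

        0≤R-1 : 0ℤ ≤ R - 1ℤ
        0≤R-1 = subst (0ℤ ≤_) (lemma R K) (0≤+ (0≤+ 0≤R-K-1 0≤K-1) (+≤+ {n = 1} z≤n))
          where
          lemma : ∀ r k → r - k - 1ℤ + (k - 1ℤ) + 1ℤ ≡ r - 1ℤ
          lemma = solve-∀

        -- The left side of `∑-outside` is a sum of squares.
        N≤R : N ≤ R
        N≤R = delsarte-arithmetic N R K 0≤R 0≤K-1 0≤R-K-1 (subst (0ℤ ≤_) ∑-outside
          (0≤∑ (blocks D) (λ {C} _ → 0≤∖ (λ C → z C * z C) S (0≤² (z C)))))

        -- For N = R the sum of squares in `∑-outside` vanishes, so `z` is 0 off `S`: R times the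
        -- weight equals K N = K R.
        weight-outside : N ≡ R → ∀ {C} → C ∈ blocks D → C ∉ S → weight C ≡ K
        weight-outside N≡R {C} C∈ C∉ = ℤ.*-cancelˡ-≡ R (weight C) K {{R≢0}}
          (trans (ℤ.i-j≡0⇒i≡j (R * weight C) (K * N) z≡0) (trans (cong (K *_) N≡R) (ℤ.*-comm K R)))
          where
          R≢0 : ℤ.NonZero R
          R≢0 = ℤ.≢-nonZero {R} (λ R≡0 → 0≰-1 0≤R-1 (cong (_- 1ℤ) R≡0))
          z²≡0 : z C * z C ≡ 0ℤ
          z²≡0 = trans (sym (∖-∉ (λ C → z C * z C) S C∉))
            (∑≡0⇒≡0 blocks! (λ {C} _ → 0≤∖ (λ C → z C * z C) S (0≤² (z C)))
              (trans ∑-outside (trans (cong (λ n → N * U * ((R - n) * (R - K))) N≡R) (lemma N U R K))) C∈)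
            where
            lemma : ∀ n u r k → n * u * ((r - r) * (r - k)) ≡ 0ℤ
            lemma = solve-∀
          z≡0 : z C ≡ 0ℤ
          z≡0 = reduce (ℤ.i*j≡0⇒i≡0∨j≡0 (z C) z²≡0)

      -- Cliques of size r without a common point

      module NoCommonPoint
        (4≤k : 4 ℕ.≤ k)
        (large : 0ℤ ≤ R - (K * K - + 3 * K + + 4))
        (N≡R : N ≡ R)
        (missed : ∀ P → ∃[ B ] (B ∈ S × P ∉ₛ B))
        where
        open Large 4≤k large

        w≤ : ∀ P → w P ≤ K
        w≤ P with missed P
        ... | _ , B∈ , P∉ = w≤K B∈ P∉

        -- The block of the design through `P` and `Q` is not in `S`, so its weight is K, and `w P`
        -- and `w Q` are two of its nonnegative terms.
        unjoined⇒ : ∀ {P Q} → P ≢ Q → Unjoined P Q → w P + w Q ≤ K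
        unjoined⇒ {P} {Q} P≢Q unj with exactly-one P≢Q
        ... | C , (C∈ , P∈ , Q∈) , _ =
          subst₂ _≤_ (cong₂ _+_ (scale P∈) (scale Q∈)) (weight-outside N≡R C∈ (λ C∈S → unj C∈S (P∈ , Q∈)))
            (pair≤∑ points! (∈-allFin P) (∈-allFin Q) P≢Q (λ {X} _ _ _ → 0≤* (ι C X) (w X) (0≤ι C X) (0≤w X)))
          where
          scale : ∀ {X} → X ∈ₛ C → ι C X * w X ≡ w X
          scale {X} X∈ = trans (cong (_* w X) (ι-∈ X∈)) (ℤ.*-identityˡ (w X))

        -- Of the K points of `B`, `w Q` are joined to `Q` and weigh at most `m` each; the other K -
        -- `w Q` weigh at most K - `w Q` each by `unjoined⇒`.
        line-bound : ∀ {m B Q} → (∀ P → w P ≤ m) → B ∈ S → Q ∉ₛ B →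
                     N + K - 1ℤ ≤ m * w Q + (K - w Q) * (K - w Q)
        line-bound {m} {B} {Q} w≤m B∈ Q∉ = subst₂ _≤_ (weight-S B∈) total
          (∑-mono points (λ {X} _ → ι-mono {B = B} {P = X} bound))
          where
          c : ℤ
          c = w Q
          j : Fin v → ℤ
          j = joint S Q
          -- Both bounds in one expression linear in `j X`, which is 1 or 0, so that `∑-line-joint`
          -- evaluates the sum.
          bound : ∀ {X} → X ∈ₛ B → w X ≤ (m - (K - c)) * j X + (K - c)
          bound {X} X∈ with joint-cases Q X (λ { refl → Q∉ X∈ })
          ... | inj₁ (_ , _ , eq) = subst (w X ≤_)
              (sym (trans (cong (λ a → (m - (K - c)) * a + (K - c)) eq) (l m (K - c)))) (w≤m X)
            where
            l : ∀ a b → (a - b) * 1ℤ + b ≡ a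
            l = solve-∀
          ... | inj₂ (unj , eq) = ≤-by (ℤ.i≤j⇒0≤j-i (unjoined⇒ (λ { refl → Q∉ X∈ }) unj))
              (trans (cong (λ a → (m - (K - c)) * a + (K - c) - w X) eq) (l m K c (w X)))
            where
            l : ∀ m k c x → (m - (k - c)) * 0ℤ + (k - c) - x ≡ k - (c + x)
            l = solve-∀
          total : ∑ points (λ X → ι B X * ((m - (K - c)) * j X + (K - c))) ≡ m * c + (K - c) * (K - c)
          total = begin
            ∑ points (λ X → ι B X * ((m - (K - c)) * j X + (K - c)))
              ≡⟨ ∑-cong points (λ {X} _ → l₁ (ι B X) (m - (K - c)) (j X) (K - c)) ⟩
            ∑ points (λ X → (m - (K - c)) * (ι B X * j X) + (K - c) * ι B X)
              ≡⟨ ∑-+ points _ _ ⟩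
            ∑ points (λ X → (m - (K - c)) * (ι B X * j X)) + ∑ points (λ X → (K - c) * ι B X)
              ≡⟨ cong₂ _+_ (trans (∑-* points (m - (K - c)) _) (cong ((m - (K - c)) *_) (∑-line-joint B∈ Q∉)))
                           (trans (∑-* points (K - c) (ι B)) (cong ((K - c) *_) (∑-block (subset B∈)))) ⟩
            (m - (K - c)) * c + (K - c) * K
              ≡⟨ l₂ m K c ⟩
            m * c + (K - c) * (K - c) ∎
            where
            l₁ : ∀ i a j b → i * (a * j + b) ≡ a * (i * j) + b * i
            l₁ = solve-∀
            l₂ : ∀ m k c → (m - (k - c)) * c + (k - c) * k ≡ m * c + (k - c) * (k - c)
            l₂ = solve-∀

        B₀ : ∃[ B ] B ∈ S
        B₀ with missed (fromℕ< k<v)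
        ... | B , B∈ , _ = B , B∈

        ∃w≡K : ∃[ P ] w P ≡ K
        ∃w≡K with Fin.any? (λ P → w P ℤ.≟ K)
        ... | yes found = found
        ... | no none with Fin.any? (λ P → w P ℤ.≟ K - 1ℤ)
        -- Here K - 1 is the largest weight, and `line-bound` at `Q` gives R + K - 1 ≤ (K - 1)² + 1,
        -- so R ≤ K² - 3K + 3, just below the assumed bound.
        ...   | yes (Q , wQ≡) = ⊥-elim (case (missed Q))
          where
          w≤K-1 : ∀ P → w P ≤ K - 1ℤ
          w≤K-1 P = ≤-by (≤∧≢⇒0≤ (w≤ P) (λ eq → none (P , eq))) (l K (w P))
            where
            l : ∀ k x → k - 1ℤ - x ≡ k - x - 1ℤ
            l = solve-∀
          l : ∀ k r → (k - 1ℤ) * (k - 1ℤ) + (k - (k - 1ℤ)) * (k - (k - 1ℤ)) - (r + k - 1ℤ)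
                + (r - (k * k - + 3 * k + + 4)) ≡ - 1ℤ
          l = solve-∀
          case : ∃[ B ] (B ∈ S × Q ∉ₛ B) → ⊥
          case (B , B∈ , Q∉) = 0≰-1 (0≤+ (ℤ.i≤j⇒0≤j-i (line-bound w≤K-1 B∈ Q∉)) large)
            (trans (cong₂ (λ c n → (K - 1ℤ) * c + (K - c) * (K - c) - (n + K - 1ℤ)
                + (R - (K * K - + 3 * K + + 4))) wQ≡ N≡R) (l K R))
        -- With all weights at most K - 2, a block of `S` gives R + K - 1 ≤ K (K - 2), so R ≤ K² -
        -- 3K + 1.
        ...   | no none′ = ⊥-elim (0≰-1 (0≤+ (0≤+ (ℤ.i≤j⇒0≤j-i weight≤) large) (+≤+ {n = 2} z≤n))
            (trans (cong (λ n → K * (K - + 2) - (n + K - 1ℤ) + (R - (K * K - + 3 * K + + 4)) + + 2) N≡R) (l K R)))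
          where
          w≤K-2 : ∀ P → w P ≤ K - + 2
          w≤K-2 P = ≤-by
            (≤∧≢⇒0≤ (≤-by (≤∧≢⇒0≤ (w≤ P) (λ eq → none (P , eq))) (l₁ K (w P))) (λ eq → none′ (P , eq)))
            (l₂ K (w P))
            where
            l₁ : ∀ k x → k - 1ℤ - x ≡ k - x - 1ℤ
            l₁ = solve-∀
            l₂ : ∀ k x → k - + 2 - x ≡ k - 1ℤ - x - 1ℤ
            l₂ = solve-∀
          weight≤ : N + K - 1ℤ ≤ K * (K - + 2)
          weight≤ = subst₂ _≤_ (weight-S (proj₂ B₀))
            (trans (∑-*ʳ points (ι (proj₁ B₀)) _) (cong (_* (K - + 2)) (∑-block (subset (proj₂ B₀)))))
            (∑-mono points (λ {X} _ → ι-mono {B = proj₁ B₀} {P = X} (λ _ → w≤K-2 X)))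
          l : ∀ k r → k * (k - + 2) - (r + k - 1ℤ) + (r - (k * k - + 3 * k + + 4)) + + 2 ≡ - 1ℤ
          l = solve-∀

        P₀ : Fin v
        P₀ = proj₁ ∃w≡K

        wP₀ : w P₀ ≡ K
        wP₀ = proj₂ ∃w≡K

        -- The points of positive weight are `P₀` and those joined to it, so the ones not joined to
        -- `Q` can be singled out by the joint counts with `P₀` and `Q`, whose sums are known. With
        -- the terms at `P₀` and `Q` split off, the comparison reads (K - c) (m (K - 1) - (R - c)) ≥
        -- 0 for c = `w Q`, and K - c is positive.
        R≤ : ∀ m Q → 0ℤ ≤ m → 0ℤ ≤ w Q - 1ℤ → w Q ≢ K →
             (∀ X → Q ≢ X → Unjoined Q X → w X ≤ m) → 0ℤ ≤ m * (K - 1ℤ) - (R - w Q)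
        R≤ m Q 0≤m 0<c c≢K unjoined≤m = cancel (m * (K - 1ℤ) - (R - c)) (subst (0ℤ ≤_)
          (trans (cong₂ _-_ ∑h (cong₂ _+_ hP hQ))
            (trans (cong (λ n → m * (K * K) + c * (n + K - 1ℤ) - n * K - m * (c * K)
                                - (m * K + 1ℤ * K - K - m * 1ℤ + (m * 1ℤ + c * c - c - m * c))) N≡R)
              (l m K R c)))
          (ℤ.i≤j⇒0≤j-i (pair≤∑ points! (∈-allFin P₀) (∈-allFin Q) P≢Q (λ {X} _ → h≥0 X))))
          where
          c : ℤ
          c = w Q
          -- Apart from P₀ and Q, the function h is m - w X at the points X of positive
          -- weight that are not joined to Q, and 0 elsewhere.
          p j h : Fin v → ℤ
          p = joint S P₀
          j = joint S Q
          h X = m * p X + j X * w X - w X - m * j X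
          P≢Q : P₀ ≢ Q
          P≢Q eq = c≢K (trans (cong w (sym eq)) wP₀)
          -- As `w P₀` is already K, `unjoined⇒` leaves no room for a positive weight.
          joined : ∀ X → P₀ ≢ X → 0ℤ ≤ w X - 1ℤ → ¬ Unjoined P₀ X
          joined X P≢X 0<w unj = 0≰-1 (0≤+ (ℤ.i≤j⇒0≤j-i (unjoined⇒ P≢X unj)) 0<w)
            (trans (cong (λ a → K - (a + w X) + (w X - 1ℤ)) wP₀) (l′ K (w X)))
            where
            l′ : ∀ k x → k - (k + x) + (x - 1ℤ) ≡ - 1ℤ
            l′ = solve-∀
          p≡1 : ∀ X → P₀ ≢ X → 0ℤ ≤ w X - 1ℤ → p X ≡ 1ℤ
          p≡1 X P≢X 0<w with joint-cases P₀ X P≢X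
          ... | inj₁ (_ , _ , eq) = eq
          ... | inj₂ (unj , _)    = ⊥-elim (joined X P≢X 0<w unj)
          jP≡1 : j P₀ ≡ 1ℤ
          jP≡1 = trans (∑-cong S (λ {B} _ → ℤ.*-comm (ι B Q) (ι B P₀))) (p≡1 Q P≢Q 0<c)
          hP : h P₀ ≡ m * K + 1ℤ * K - K - m * 1ℤ
          hP = cong₂ (λ { (a , b) d → m * a + d * b - b - m * d }) (cong₂ _,_ (trans (joint-refl P₀) wP₀) wP₀) jP≡1
          hQ : h Q ≡ m * 1ℤ + c * c - c - m * c
          hQ = cong₂ (λ a d → m * a + d * c - c - m * d) (p≡1 Q P≢Q 0<c) (joint-refl Q)
          ∑h : ∑ points h ≡ m * (K * K) + c * (N + K - 1ℤ) - N * K - m * (c * K)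
          ∑h = trans (∑-- points _ _) (cong₂ _-_
            (trans (∑-- points _ w) (cong₂ _-_
              (trans (∑-+ points _ _) (cong₂ _+_
                (trans (∑-* points m p) (cong (m *_) (trans (∑-joint-S P₀) (cong (_* K) wP₀))))
                (trans (∑-cong points (λ {X} _ → ℤ.*-comm (j X) (w X))) (∑-w-joint Q))))
              ∑w))
            (trans (∑-* points m j) (cong (m *_) (∑-joint-S Q))))
          h≥0 : ∀ X → X ≢ P₀ → X ≢ Q → 0ℤ ≤ h X
          h≥0 X X≢P X≢Q with joint-cases Q X (X≢Q ∘ sym) | w X ℤ.≟ 0ℤ
          ... | inj₁ (B , (B∈ , _ , X∈) , eq) | _ = ℤ.≤-reflexive (sym (trans
              (cong₂ (λ a d → m * a + d * w X - w X - m * d) (p≡1 X (X≢P ∘ sym) (w≥1 B∈ X∈)) eq) (l′ m (w X))))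
            where
            l′ : ∀ m x → m * 1ℤ + 1ℤ * x - x - m * 1ℤ ≡ 0ℤ
            l′ = solve-∀
          -- At weight 0 only the term m p X survives; this is where 0 ≤ m enters.
          ... | inj₂ (_ , eq) | yes w≡0 = subst (0ℤ ≤_)
              (sym (trans (cong₂ (λ a d → m * p X + d * a - a - m * d) w≡0 eq) (l′ m (p X))))
              (0≤* m (p X) 0≤m (0≤∑ S (λ {B} _ → 0≤* (ι B P₀) (ι B X) (0≤ι B P₀) (0≤ι B X))))
            where
            l′ : ∀ m p → m * p + 0ℤ * 0ℤ - 0ℤ - m * 0ℤ ≡ m * p
            l′ = solve-∀
          ... | inj₂ (unj , eq) | no w≢0 = subst (0ℤ ≤_)
              (sym (trans (cong₂ (λ a d → m * a + d * w X - w X - m * d) (p≡1 X (X≢P ∘ sym) 0<w) eq) (l′ m (w X))))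
              (ℤ.i≤j⇒0≤j-i (unjoined≤m X (X≢Q ∘ sym) unj))
            where
            0<w : 0ℤ ≤ w X - 1ℤ
            0<w = subst (λ a → 0ℤ ≤ a - 1ℤ) (ℤ.+-identityʳ (w X)) (≤∧≢⇒0≤ (0≤w X) (w≢0 ∘ sym))
            l′ : ∀ m x → m * 1ℤ + 0ℤ * x - x - m * 0ℤ ≡ m - x
            l′ = solve-∀
          l : ∀ m k r c → m * (k * k) + c * (r + k - 1ℤ) - r * k - m * (c * k)
                - (m * k + 1ℤ * k - k - m * 1ℤ + (m * 1ℤ + c * c - c - m * c))
              ≡ (k - c) * (m * (k - 1ℤ) - (r - c))
          l = solve-∀
          cancel : ∀ a → 0ℤ ≤ (K - c) * a → 0ℤ ≤ a
          cancel a = 0≤*⇒0≤ (K - c) a (≤∧≢⇒0≤ (w≤ Q) c≢K)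

        -- For c = `w Q`, `unjoined⇒` allows m = K - c in `R≤`. If c ≥ 3, then R ≤ K² - K - c (K -
        -- 2) ≤ K² - 4K + 6, which is less than K² - 3K + 4 because K > 2.
        w≤2 : ∀ Q → 0ℤ ≤ w Q - 1ℤ → w Q ≢ K → w Q ≤ + 2
        w≤2 Q 0<w w≢K with w Q ℤ.≤? + 2
        ... | yes le = le
        ... | no ≰2 = ⊥-elim (0≰-1
          (0≤+ (0≤+ (0≤+ key large)
                    (0≤* (K - + 2) (w Q - + 2 - 1ℤ) (0≤K- 2 (s≤s (s≤s z≤n))) (<⇒0≤ (ℤ.≰⇒> ≰2))))
               (0≤K- 3 (s≤s (s≤s (s≤s z≤n)))))
          (l K R (w Q)))
          where
          0≤K- : ∀ a → a ℕ.≤ 4 → 0ℤ ≤ K - + a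
          0≤K- a le = ℤ.i≤j⇒0≤j-i (ℤ.≤-trans (+≤+ le) (4≤K 4≤k))
          key : 0ℤ ≤ (K - w Q) * (K - 1ℤ) - (R - w Q)
          key = R≤ (K - w Q) Q (ℤ.i≤j⇒0≤j-i (w≤ Q)) 0<w w≢K (λ X Q≢X unj →
                  ≤-by (ℤ.i≤j⇒0≤j-i (unjoined⇒ Q≢X unj)) (l′ K (w Q) (w X)))
            where
            l′ : ∀ k c x → k - c - x ≡ k - (c + x)
            l′ = solve-∀
          l : ∀ k r c → (k - c) * (k - 1ℤ) - (r - c) + (r - (k * k - + 3 * k + + 4))
                + (k - + 2) * (c - + 2 - 1ℤ) + (k - + 3) ≡ - 1ℤ
          l = solve-∀

        w≡K : ¬ (r ≡ 8 × k ≡ 4) → ∀ Q → 0ℤ ≤ w Q - 1ℤ → w Q ≡ K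
        w≡K ¬8,4 Q 0<w with w Q ℤ.≟ K
        ... | yes eq = eq
        ... | no w≢K = ⊥-elim (exceptional (+ 4 ℤ.≟ K))
          where
          unjoined≤2 : ∀ X → Q ≢ X → Unjoined Q X → w X ≤ + 2
          unjoined≤2 X Q≢X unj with w X ℤ.≤? + 2
          ... | yes le = le
          -- `w X` cannot be K, because `X` is not joined to `Q` and `w Q` is positive; so `w≤2`
          -- applies to `X` as well.
          ... | no ≰2 = w≤2 X (subst (0ℤ ≤_) (l₁ (w X)) (0≤+ (<⇒0≤ (ℤ.≰⇒> ≰2)) (+≤+ {n = 2} z≤n)))
            (λ eq → 0≰-1 (0≤+ (ℤ.i≤j⇒0≤j-i (unjoined⇒ Q≢X unj)) 0<w)
              (trans (cong (λ a → K - (w Q + a) + (w Q - 1ℤ)) eq) (l₂ K (w Q))))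
            where
            l₁ : ∀ x → x - + 2 - 1ℤ + + 2 ≡ x - 1ℤ
            l₁ = solve-∀
            l₂ : ∀ k c → k - (c + k) + (c - 1ℤ) ≡ - 1ℤ
            l₂ = solve-∀
          R≤2K : 0ℤ ≤ + 2 * K - R
          R≤2K = subst (0ℤ ≤_) (l K R (w Q))
            (0≤+ (R≤ (+ 2) Q (+≤+ z≤n) 0<w w≢K unjoined≤2) (ℤ.i≤j⇒0≤j-i (w≤2 Q 0<w w≢K)))
            where
            l : ∀ k r c → + 2 * (k - 1ℤ) - (r - c) + (+ 2 - c) ≡ + 2 * k - r
            l = solve-∀
          exceptional : Dec (+ 4 ≡ K) → ⊥
          -- At K = 4 the bounds 2K and K² - 3K + 4 are both 8.
          exceptional (yes 4≡K) = ¬8,4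
            ( ℤ.+-injective (trans +r≡R (ℤ.≤-antisym
                (ℤ.0≤i-j⇒j≤i (subst (λ a → 0ℤ ≤ + 2 * a - R) (sym 4≡K) R≤2K))
                (ℤ.0≤i-j⇒j≤i (subst (λ a → 0ℤ ≤ R - (a * a - + 3 * a + + 4)) (sym 4≡K) large))))
            , ℤ.+-injective (trans +k≡K (sym 4≡K)))
          -- From K = 5 on, K² - 3K + 4 exceeds 2K.
          exceptional (no 4≢K) = 0≰-1
            (0≤+ (0≤+ (0≤+ R≤2K large) (0≤* K (K - + 4 - 1ℤ) 0≤K (≤∧≢⇒0≤ (4≤K 4≤k) 4≢K))) (+≤+ {n = 3} z≤n))
            (l K R)
            where
            l : ∀ k r → + 2 * k - r + (r - (k * k - + 3 * k + + 4)) + k * (k - + 4 - 1ℤ) + + 3 ≡ - 1ℤ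
            l = solve-∀

        R≡K²-K+1 : ¬ (r ≡ 8 × k ≡ 4) → R ≡ K * K - K + 1ℤ
        R≡K²-K+1 ¬8,4 = begin
          R                       ≡⟨ l₁ R K ⟩
          R + K - 1ℤ - K + 1ℤ     ≡⟨ cong (λ n → n + K - 1ℤ - K + 1ℤ) (sym N≡R) ⟩
          N + K - 1ℤ - K + 1ℤ     ≡⟨ cong (λ a → a - K + 1ℤ) (trans (sym (weight-S L∈)) weight≡K²) ⟩
          K * K - K + 1ℤ          ∎
          where
          L : Subset v
          L = proj₁ B₀
          L∈ : L ∈ S
          L∈ = proj₂ B₀
          l₁ : ∀ r k → r ≡ r + k - 1ℤ - k + 1ℤ
          l₁ = solve-∀
          term : ∀ X → ι L X * w X ≡ ι L X * K
          term X with X ∈ₛ? L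
          ... | yes X∈ = cong (1ℤ *_) (w≡K ¬8,4 X (w≥1 L∈ X∈))
          ... | no _   = refl
          weight≡K² : weight L ≡ K * K
          weight≡K² = trans (∑-cong points (λ {X} _ → term X))
                   (trans (∑-*ʳ points (ι L) K) (cong (_* K) (∑-block (subset L∈))))

-- The theorem over the natural numbers.

open import Data.Nat using (_+_; _*_; _≤_)

corollary5p6 : ∀ (v k r : ℕ) (D : Design v k) →
    4 ≤ k →
    r * (k ∸ 1) ≡ v ∸ 1 →
    LargeReplication r k →
    (S : List (Subset v)) → IsErdősKoRado D S →
    (length S ≤ r) ×
    (r ≢ k ^ 2 ∸ k + 1 → ¬ (r ≡ 8 × k ≡ 4) →
    (length S ≡ r ⇔ IsPointPencil D S))
corollary5p6 v k r D 4≤k r-eq large S ekr =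
  ℤ.drop‿+≤+ (subst₂ ℤ._≤_ (sym +length≡N) (sym +r≡R) (Large.N≤R 4≤k large′)) ,
  λ r≢ ¬8,4 → mk⇔ (pencil r≢ ¬8,4)
                   (λ p → ℤ.+-injective (trans +length≡N (trans (pencil⇒N≡R p) (sym +r≡R))))
  where
  open Counting
  open DesignCounts {v} {k} {r} D r-eq
  open Intersecting ekr
  large′ = K²-3K+4≤R 4≤k large
  pencil : r ≢ k ^ 2 ∸ k + 1 → ¬ (r ≡ 8 × k ≡ 4) → length S ≡ r → IsPointPencil D S
  pencil r≢ ¬8,4 n≡r with Fin.any? (λ P → All.all? (P ∈ₛ?_) S)
  ... | yes (P , all) = common⇒pencil (trans (sym +length≡N) (trans (cong ℤ.+_ n≡r) +r≡R)) (All.lookup all)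
  -- Without a common point r would be the excluded value k² - k + 1.
  ... | no none = contradiction r≡ r≢
    where
    missed : ∀ P → ∃[ B ] (B ∈ S × P ∉ₛ B)
    missed P = find (¬All⇒Any¬ (P ∈ₛ?_) S (λ all → none (P , all)))
    open NoCommonPoint 4≤k large′ (trans (sym +length≡N) (trans (cong ℤ.+_ n≡r) +r≡R)) missed
    r≡ : r ≡ k ^ 2 ∸ k + 1
    r≡ = ℤ.+-injective (trans +r≡R (trans (R≡K²-K+1 ¬8,4)
      (trans (cong (λ a → a ℤ.* a ℤ.- a ℤ.+ ℤ.1ℤ) (sym +k≡K)) (pos-k²-k+1 k (ℕ.≤-trans (s≤s z≤n) 4≤k)))))
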